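{- Let $(K,|\cdot|)$ be an algebraically closed non-archimedean valued field of characteristic $0$, with valuation ring $\mathcal{O}_K=\{x\in K: |x|\le 1\}$ and maximal ideal $\mathfrak{m}_K=\{x\in K:|x|<1\}$. Let $f(z)=z^n+a_{n-1}z^{n-1}+\cdots+a_1z+a_0\in K[z]$ be monic of degree $n\ge 2$ such that all zeros of $f$ lie in the closed unit disk $\{x\in K:|x|\le 1\}$ (equivalently $a_i\in\mathcal{O}_K$ for all $i$). Define $$I(f)=\max_{z:\,f(z)=0}\ \min_{w:\,f'(w)=0}|z-w|.$$ Assume $|n|=1$. Then $I(f)=1$ if and only if $\overline{f}$ does not divide $\overline{f'}^{\,n}$ in $(\mathcal{O}_K/\mathfrak{m}_K)[z]$, where the bar denotes coefficientwise reduction modulo $\mathfrak{m}_K$.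
   Context: A non-archimedean field is a field with an absolute value satisfying $|x+y|\le\max\{|x|,|y|\}$; the integer $n$ is viewed as an element of $K$. Here $1=|n|^{ -1/(n-1)}$ is the optimal upper bound for $I(f)$. -}

module Defs where

open import Level using (Level; _⊔_) renaming (suc to lsuc)
open import Algebra.Bundles using (CommutativeRing)
open import Data.Nat using (ℕ; zero; suc) renaming (_≤_ to _≤ℕ_)
open import Data.List using (List; []; _∷_; _++_; [_])
open import Data.Vec using (Vec; toList)
open import Data.Product using (Σ; ∃; _×_; _,_)
open import Data.Sum using (_⊎_)
open import Relation.Nullary using (¬_)
open import Relation.Binary.PropositionalEquality using (_≡_)

record IsField {c ℓ : Level} (R : CommutativeRing c ℓ) : Set (c ⊔ ℓ) where
  open CommutativeRing R
  field
    nontrivial : ¬ (1# ≈ 0#)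
    inverse    : ∀ x → ¬ (x ≈ 0#) → ∃ λ y → x * y ≈ 1#

module Poly {c ℓ : Level} (R : CommutativeRing c ℓ) where
  open CommutativeRing R

  -- Polynomials as coefficient lists, constant term first: a₀ ∷ a₁ ∷ … .
  Pol : Set c
  Pol = List Carrier

  natK : ℕ → Carrier
  natK zero    = 0#
  natK (suc n) = 1# + natK n

  coeff : Pol → ℕ → Carrier
  coeff []      _       = 0#
  coeff (a ∷ p) zero    = a
  coeff (a ∷ p) (suc i) = coeff p i

  eval : Pol → Carrier → Carrier
  eval []      x = 0#
  eval (a ∷ p) x = a + x * eval p x

  _⊕_ : Pol → Pol → Pol
  []      ⊕ q       = q
  (a ∷ p) ⊕ []      = a ∷ p
  (a ∷ p) ⊕ (b ∷ q) = (a + b) ∷ (p ⊕ q)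

  scale : Carrier → Pol → Pol
  scale a []      = []
  scale a (b ∷ q) = (a * b) ∷ scale a q

  neg : Pol → Pol
  neg = scale (- 1#)

  _⊗_ : Pol → Pol → Pol
  []      ⊗ q = []
  (a ∷ p) ⊗ q = scale a q ⊕ (0# ∷ (p ⊗ q))

  _^^_ : Pol → ℕ → Pol
  p ^^ zero  = 1# ∷ []
  p ^^ suc n = p ⊗ (p ^^ n)

  derivAux : ℕ → Pol → Pol
  derivAux k []      = []
  derivAux k (a ∷ p) = (natK k * a) ∷ derivAux (suc k) p

  deriv : Pol → Pol
  deriv []      = []
  deriv (a ∷ p) = derivAux 1 p

  monic : ∀ {n} → Vec Carrier n → Pol
  monic a = toList a ++ [ 1# ]

  NonConstant : Pol → Set ℓ
  NonConstant p = ∃ λ i → ¬ (coeff p (suc i) ≈ 0#)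

  AlgClosed : Set (c ⊔ ℓ)
  AlgClosed = ∀ p → NonConstant p → ∃ λ x → eval p x ≈ 0#

  CharZero : Set ℓ
  CharZero = ∀ m → ¬ (natK (suc m) ≈ 0#)

-- A non-archimedean absolute value on R, with values in a totally ordered
-- commutative monoid with absorbing least element 0 (abstracting ℝ≥0).
record NonArchAbs {c ℓ : Level} (R : CommutativeRing c ℓ) : Set (lsuc c ⊔ ℓ) where
  open CommutativeRing R
  field
    Γ     : Set c
    _≤ᵥ_  : Γ → Γ → Set c
    0ᵥ 1ᵥ : Γ
    _·ᵥ_  : Γ → Γ → Γ
    ≤-refl    : ∀ {u} → u ≤ᵥ u
    ≤-trans   : ∀ {u v w} → u ≤ᵥ v → v ≤ᵥ w → u ≤ᵥ w
    ≤-antisym : ∀ {u v} → u ≤ᵥ v → v ≤ᵥ u → u ≡ v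
    ≤-total   : ∀ u v → (u ≤ᵥ v) ⊎ (v ≤ᵥ u)
    ·-comm    : ∀ u v → (u ·ᵥ v) ≡ (v ·ᵥ u)
    ·-assoc   : ∀ u v w → ((u ·ᵥ v) ·ᵥ w) ≡ (u ·ᵥ (v ·ᵥ w))
    ·-identity : ∀ u → (1ᵥ ·ᵥ u) ≡ u
    ·-zero    : ∀ u → (0ᵥ ·ᵥ u) ≡ 0ᵥ
    ·-mono    : ∀ {u v} w → u ≤ᵥ v → (u ·ᵥ w) ≤ᵥ (v ·ᵥ w)
    ·-cancel  : ∀ {u v} w → ¬ (w ≡ 0ᵥ) → (u ·ᵥ w) ≡ (v ·ᵥ w) → u ≡ v
    0-least   : ∀ u → 0ᵥ ≤ᵥ u
    ∣_∣       : Carrier → Γ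
    abs-cong  : ∀ {x y} → x ≈ y → ∣ x ∣ ≡ ∣ y ∣
    abs-zero  : ∀ x → ∣ x ∣ ≡ 0ᵥ → x ≈ 0#
    abs-zero′ : ∣ 0# ∣ ≡ 0ᵥ
    abs-mult  : ∀ x y → ∣ x * y ∣ ≡ (∣ x ∣ ·ᵥ ∣ y ∣)
    ultra     : ∀ x y → (∣ x + y ∣ ≤ᵥ ∣ x ∣) ⊎ (∣ x + y ∣ ≤ᵥ ∣ y ∣)

module Valued {c ℓ : Level} (R : CommutativeRing c ℓ) (V : NonArchAbs R) where
  open CommutativeRing R
  open NonArchAbs V
  open Poly R

  _<ᵥ_ : Γ → Γ → Set c
  u <ᵥ v = (u ≤ᵥ v) × ¬ (u ≡ v)

  InO : Carrier → Set c
  InO x = ∣ x ∣ ≤ᵥ 1ᵥ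

  InM : Carrier → Set c
  InM x = ∣ x ∣ <ᵥ 1ᵥ

  IsMinDist : Pol → Carrier → Γ → Set (c ⊔ ℓ)
  IsMinDist f z u =
    (∃ λ w → (eval (deriv f) w ≈ 0#) × (∣ z - w ∣ ≡ u)) ×
    (∀ w → eval (deriv f) w ≈ 0# → u ≤ᵥ ∣ z - w ∣)

  IsI : Pol → Γ → Set (c ⊔ ℓ)
  IsI f u =
    (∃ λ z → (eval f z ≈ 0#) × IsMinDist f z u) ×
    (∀ z v → eval f z ≈ 0# → IsMinDist f z v → v ≤ᵥ u)

  -- reduction mod 𝔪_K: p̄ divides q̄ in (𝒪_K/𝔪_K)[z], for p, q ∈ 𝒪_K[z]:
  -- there is g ∈ 𝒪_K[z] with p·g ≡ q coefficientwise modulo 𝔪_K.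
  ResDivides : Pol → Pol → Set c
  ResDivides p q =
    ∃ λ g → (∀ i → InO (coeff g i)) ×
            (∀ i → InM (coeff ((p ⊗ g) ⊕ neg q) i))

{-# OPTIONS --safe #-}

-- Since |n| = 1, the critical points of f lie in the unit disk, so I(f) ≤ 1, and |f′(z)| is the
-- product of the distances |z − w| ≤ 1 from z to the critical points w. Hence I(f) = 1 exactly
-- when some root z of f has |f′(z)| = 1, i.e. when not every reduced root of f̄ is a root of f̄′.
-- As f̄ is a product of n linear factors, all its roots are roots of f̄′ exactly when f̄ divides f̄′ⁿ.
module Submission where

open import Defs
open import Level using (_⊔_)
open import Algebra.Bundles using (CommutativeMonoid; CommutativeRing)
open import Data.Nat using (ℕ; zero; suc; s≤s) renaming (_≤_ to _≤ℕ_; _+_ to _+ℕ_)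
import Data.Nat.Properties as ℕ
open import Data.Vec using (Vec; []; _∷_)
open import Data.List using ([]; _∷_)
open import Data.Empty using (⊥-elim)
open import Data.Sum using (_⊎_; inj₁; inj₂)
open import Function using (case_of_)
open import Data.Product using (_×_; _,_; ∃)
open import Relation.Nullary using (¬_; Dec; yes; no)
open import Relation.Binary.PropositionalEquality using (_≡_)
import Relation.Binary.PropositionalEquality as ≡

-- The commutative ring of polynomials.

module PolynomialRing {c ℓ} (R : CommutativeRing c ℓ) where
  open CommutativeRing R
  open Poly R
  open import Algebra.Properties.Ring ring using (-‿distribˡ-*)
  open import Algebra.Properties.CommutativeSemigroup
    (CommutativeMonoid.commutativeSemigroup +-commutativeMonoid)
    using (interchange; x∙yz≈y∙xz)
  open import Algebra.Solver.Ring.NaturalCoefficients.Default commutativeSemiring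
    using (solve; _:=_; _:+_; _:*_; con)
  open import Relation.Binary.Reasoning.Setoid setoid

  infix 4 _≋_
  -- Lists that differ by trailing zeros represent the same polynomial, so equality compares
  -- coefficients. The record wrapper lets `p` and `q` be inferred from an equation.
  record _≋_ (p q : Pol) : Set ℓ where
    constructor coeffwise
    field coeffs : ∀ i → coeff p i ≈ coeff q i
  open _≋_ public

  ≋-refl : ∀ {p} → p ≋ p
  ≋-refl .coeffs _ = refl

  ≋-sym : ∀ {p q} → p ≋ q → q ≋ p
  ≋-sym e .coeffs i = sym (coeffs e i)

  ≋-trans : ∀ {p q r} → p ≋ q → q ≋ r → p ≋ r
  ≋-trans e e′ .coeffs i = trans (coeffs e i) (coeffs e′ i)

  coeff-⊕ : ∀ p q i → coeff (p ⊕ q) i ≈ coeff p i + coeff q i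
  coeff-⊕ []      q       i       = sym (+-identityˡ _)
  coeff-⊕ (a ∷ p) []      i       = sym (+-identityʳ _)
  coeff-⊕ (a ∷ p) (b ∷ q) zero    = refl
  coeff-⊕ (a ∷ p) (b ∷ q) (suc i) = coeff-⊕ p q i

  coeff-scale : ∀ a p i → coeff (scale a p) i ≈ a * coeff p i
  coeff-scale a []      i       = sym (zeroʳ a)
  coeff-scale a (b ∷ p) zero    = refl
  coeff-scale a (b ∷ p) (suc i) = coeff-scale a p i

  coeff-neg : ∀ p i → coeff (neg p) i ≈ - coeff p i
  coeff-neg p i = begin
    coeff (neg p) i      ≈⟨ coeff-scale (- 1#) p i ⟩
    - 1# * coeff p i     ≈⟨ -‿distribˡ-* 1# _ ⟨
    - (1# * coeff p i)   ≈⟨ -‿cong (*-identityˡ _) ⟩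
    - coeff p i          ∎

  coeff-∷-⊗ : ∀ a p q i →
    coeff ((a ∷ p) ⊗ q) i ≈ a * coeff q i + coeff (0# ∷ (p ⊗ q)) i
  coeff-∷-⊗ a p q i = trans (coeff-⊕ (scale a q) _ i) (+-congʳ (coeff-scale a q i))

  ∷-cong : ∀ {a b p q} → a ≈ b → p ≋ q → (a ∷ p) ≋ (b ∷ q)
  ∷-cong a≈b p≋q .coeffs zero    = a≈b
  ∷-cong a≈b p≋q .coeffs (suc i) = coeffs p≋q i

  0∷-⊕ : ∀ p q → (0# ∷ (p ⊕ q)) ≋ ((0# ∷ p) ⊕ (0# ∷ q))
  0∷-⊕ p q = ∷-cong (sym (+-identityˡ 0#)) ≋-refl

  ⊕-cong : ∀ {p p′ q q′} → p ≋ p′ → q ≋ q′ → (p ⊕ q) ≋ (p′ ⊕ q′)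
  ⊕-cong {p} {p′} {q} {q′} e e′ .coeffs i = begin
    coeff (p ⊕ q) i           ≈⟨ coeff-⊕ p q i ⟩
    coeff p i + coeff q i     ≈⟨ +-cong (coeffs e i) (coeffs e′ i) ⟩
    coeff p′ i + coeff q′ i   ≈⟨ coeff-⊕ p′ q′ i ⟨
    coeff (p′ ⊕ q′) i         ∎

  ⊕-assoc : ∀ p q r → ((p ⊕ q) ⊕ r) ≋ (p ⊕ (q ⊕ r))
  ⊕-assoc p q r .coeffs i = begin
    coeff ((p ⊕ q) ⊕ r) i                 ≈⟨ trans (coeff-⊕ (p ⊕ q) r i) (+-congʳ (coeff-⊕ p q i)) ⟩
    coeff p i + coeff q i + coeff r i     ≈⟨ +-assoc _ _ _ ⟩
    coeff p i + (coeff q i + coeff r i)   ≈⟨ trans (coeff-⊕ p (q ⊕ r) i) (+-congˡ (coeff-⊕ q r i)) ⟨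
    coeff (p ⊕ (q ⊕ r)) i                 ∎

  ⊕-comm : ∀ p q → (p ⊕ q) ≋ (q ⊕ p)
  ⊕-comm p q .coeffs i =
    trans (coeff-⊕ p q i) (trans (+-comm _ _) (sym (coeff-⊕ q p i)))

  ⊕-identityʳ : ∀ p → (p ⊕ []) ≋ p
  ⊕-identityʳ p = ⊕-comm p []

  neg-cong : ∀ {p q} → p ≋ q → neg p ≋ neg q
  neg-cong {p} {q} e .coeffs i =
    trans (coeff-neg p i) (trans (-‿cong (coeffs e i)) (sym (coeff-neg q i)))

  ⊕-inverseʳ : ∀ p → (p ⊕ neg p) ≋ []
  ⊕-inverseʳ p .coeffs i = begin
    coeff (p ⊕ neg p) i         ≈⟨ coeff-⊕ p (neg p) i ⟩
    coeff p i + coeff (neg p) i ≈⟨ +-congˡ (coeff-neg p i) ⟩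
    coeff p i + - coeff p i     ≈⟨ -‿inverseʳ _ ⟩
    0#                          ∎

  ⊗-congˡ : ∀ p {q q′} → q ≋ q′ → (p ⊗ q) ≋ (p ⊗ q′)
  ⊗-congˡ []      e = ≋-refl
  ⊗-congˡ (a ∷ p) {q} {q′} e .coeffs i = begin
    coeff ((a ∷ p) ⊗ q) i                     ≈⟨ coeff-∷-⊗ a p q i ⟩
    a * coeff q i  + coeff (0# ∷ (p ⊗ q)) i   ≈⟨ +-cong (*-congˡ (coeffs e i))
                                                   (coeffs (∷-cong refl (⊗-congˡ p e)) i) ⟩
    a * coeff q′ i + coeff (0# ∷ (p ⊗ q′)) i  ≈⟨ coeff-∷-⊗ a p q′ i ⟨
    coeff ((a ∷ p) ⊗ q′) i                    ∎

  ⊗-zeroʳ : ∀ p → (p ⊗ []) ≋ []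
  ⊗-zeroʳ []      = ≋-refl
  ⊗-zeroʳ (a ∷ p) .coeffs zero    = refl
  ⊗-zeroʳ (a ∷ p) .coeffs (suc i) = coeffs (⊗-zeroʳ p) i

  -- The mirror image of the recursive clause of `_⊗_`, with the right factor split instead of the
  -- left; commutativity then follows by induction.
  ⊗-∷ : ∀ p b q → (p ⊗ (b ∷ q)) ≋ (scale b p ⊕ (0# ∷ (p ⊗ q)))
  ⊗-∷ [] b q .coeffs zero    = refl
  ⊗-∷ [] b q .coeffs (suc i) = refl
  ⊗-∷ (a ∷ p) b q .coeffs zero = +-congʳ (*-comm a b)
  ⊗-∷ (a ∷ p) b q .coeffs (suc i) = begin
    coeff (scale a q ⊕ (p ⊗ (b ∷ q))) i
      ≈⟨ coeff-⊕ (scale a q) _ i ⟩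
    coeff (scale a q) i + coeff (p ⊗ (b ∷ q)) i
      ≈⟨ +-congˡ (trans (coeffs (⊗-∷ p b q) i) (coeff-⊕ (scale b p) _ i)) ⟩
    coeff (scale a q) i + (coeff (scale b p) i + coeff (0# ∷ (p ⊗ q)) i)
      ≈⟨ x∙yz≈y∙xz _ _ _ ⟩
    coeff (scale b p) i + (coeff (scale a q) i + coeff (0# ∷ (p ⊗ q)) i)
      ≈⟨ +-congˡ (coeff-⊕ (scale a q) _ i) ⟨
    coeff (scale b p) i + coeff ((a ∷ p) ⊗ q) i
      ≈⟨ coeff-⊕ (scale b p) _ i ⟨
    coeff (scale b p ⊕ ((a ∷ p) ⊗ q)) i ∎

  ⊗-comm : ∀ p q → (p ⊗ q) ≋ (q ⊗ p)
  ⊗-comm []      q = ≋-sym (⊗-zeroʳ q)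
  ⊗-comm (a ∷ p) q = ≋-trans
    (⊕-cong (≋-refl {scale a q}) (∷-cong refl (⊗-comm p q)))
    (≋-sym (⊗-∷ q a p))

  -- The product recurses on its left factor, and equal polynomials may have lists of different
  -- lengths. Commutativity moves the left factor to the right, where `⊗-congˡ` applies.
  ⊗-cong : ∀ {p p′ q q′} → p ≋ p′ → q ≋ q′ → (p ⊗ q) ≋ (p′ ⊗ q′)
  ⊗-cong {p} {p′} {q} {q′} e e′ =
    ≋-trans (⊗-congˡ p e′)
    (≋-trans (⊗-comm p q′) (≋-trans (⊗-congˡ q′ e) (⊗-comm q′ p′)))

  ⊗-distribˡ-⊕ : ∀ p q r → (p ⊗ (q ⊕ r)) ≋ ((p ⊗ q) ⊕ (p ⊗ r))
  ⊗-distribˡ-⊕ []      q r = ≋-refl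
  ⊗-distribˡ-⊕ (a ∷ p) q r .coeffs i = begin
    coeff ((a ∷ p) ⊗ (q ⊕ r)) i
      ≈⟨ coeff-∷-⊗ a p (q ⊕ r) i ⟩
    a * coeff (q ⊕ r) i + coeff (0# ∷ (p ⊗ (q ⊕ r))) i
      ≈⟨ +-cong (trans (*-congˡ (coeff-⊕ q r i)) (distribˡ _ _ _))
           (trans (coeffs (≋-trans (∷-cong refl (⊗-distribˡ-⊕ p q r))
                                   (0∷-⊕ (p ⊗ q) (p ⊗ r))) i)
                  (coeff-⊕ (0# ∷ (p ⊗ q)) (0# ∷ (p ⊗ r)) i)) ⟩
    (a * coeff q i + a * coeff r i) + (coeff (0# ∷ (p ⊗ q)) i + coeff (0# ∷ (p ⊗ r)) i)
      ≈⟨ interchange _ _ _ _ ⟩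
    (a * coeff q i + coeff (0# ∷ (p ⊗ q)) i) + (a * coeff r i + coeff (0# ∷ (p ⊗ r)) i)
      ≈⟨ +-cong (coeff-∷-⊗ a p q i) (coeff-∷-⊗ a p r i) ⟨
    coeff ((a ∷ p) ⊗ q) i + coeff ((a ∷ p) ⊗ r) i
      ≈⟨ coeff-⊕ ((a ∷ p) ⊗ q) _ i ⟨
    coeff (((a ∷ p) ⊗ q) ⊕ ((a ∷ p) ⊗ r)) i ∎

  ⊗-distribʳ-⊕ : ∀ r p q → ((p ⊕ q) ⊗ r) ≋ ((p ⊗ r) ⊕ (q ⊗ r))
  ⊗-distribʳ-⊕ r p q =
    ≋-trans (⊗-comm (p ⊕ q) r)
    (≋-trans (⊗-distribˡ-⊕ r p q) (⊕-cong (⊗-comm r p) (⊗-comm r q)))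

  scale-⊗ : ∀ a p q → (scale a p ⊗ q) ≋ scale a (p ⊗ q)
  scale-⊗ a []      q = ≋-refl
  scale-⊗ a (b ∷ p) q .coeffs i = begin
    coeff (((a * b) ∷ scale a p) ⊗ q) i
      ≈⟨ coeff-∷-⊗ (a * b) (scale a p) q i ⟩
    a * b * coeff q i + coeff (0# ∷ (scale a p ⊗ q)) i
      ≈⟨ +-cong (*-assoc a b _) (coeffs (∷-cong (sym (zeroʳ a)) (scale-⊗ a p q)) i) ⟩
    a * (b * coeff q i) + coeff (scale a (0# ∷ (p ⊗ q))) i
      ≈⟨ +-congˡ (coeff-scale a (0# ∷ (p ⊗ q)) i) ⟩
    a * (b * coeff q i) + a * coeff (0# ∷ (p ⊗ q)) i
      ≈⟨ distribˡ _ _ _ ⟨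
    a * (b * coeff q i + coeff (0# ∷ (p ⊗ q)) i)
      ≈⟨ *-congˡ (coeff-∷-⊗ b p q i) ⟨
    a * coeff ((b ∷ p) ⊗ q) i
      ≈⟨ coeff-scale a ((b ∷ p) ⊗ q) i ⟨
    coeff (scale a ((b ∷ p) ⊗ q)) i ∎

  0∷-⊗ : ∀ p q → ((0# ∷ p) ⊗ q) ≋ (0# ∷ (p ⊗ q))
  0∷-⊗ p q .coeffs i =
    trans (coeff-∷-⊗ 0# p q i) (trans (+-congʳ (zeroˡ _)) (+-identityˡ _))

  ⊗-assoc : ∀ p q r → ((p ⊗ q) ⊗ r) ≋ (p ⊗ (q ⊗ r))
  ⊗-assoc []      q r = ≋-refl
  ⊗-assoc (a ∷ p) q r = ≋-trans
    (⊗-distribʳ-⊕ r (scale a q) (0# ∷ (p ⊗ q)))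
    (⊕-cong (scale-⊗ a q r)
            (≋-trans (0∷-⊗ (p ⊗ q) r) (∷-cong refl (⊗-assoc p q r))))

  ⊗-identityˡ : ∀ p → ((1# ∷ []) ⊗ p) ≋ p
  ⊗-identityˡ p .coeffs i = begin
    coeff ((1# ∷ []) ⊗ p) i            ≈⟨ coeff-∷-⊗ 1# [] p i ⟩
    1# * coeff p i + coeff (0# ∷ []) i ≈⟨ +-cong (*-identityˡ _) (0∷[] i) ⟩
    coeff p i + 0#                     ≈⟨ +-identityʳ _ ⟩
    coeff p i                          ∎
    where
    0∷[] : ∀ i → coeff (0# ∷ []) i ≈ 0#
    0∷[] zero    = refl
    0∷[] (suc _) = refl

  polynomialRing : CommutativeRing c ℓ
  polynomialRing = record
    { Carrier = Pol ; _≈_ = _≋_ ; _+_ = _⊕_ ; _*_ = _⊗_ ; -_ = neg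
    ; 0# = [] ; 1# = 1# ∷ []
    ; isCommutativeRing = record
      { isRing = record
        { +-isAbelianGroup = record
          { isGroup = record
            { isMonoid = record
              { isSemigroup = record
                { isMagma = record
                  { isEquivalence = record { refl = ≋-refl ; sym = ≋-sym ; trans = ≋-trans }
                  ; ∙-cong = ⊕-cong }
                ; assoc = ⊕-assoc }
              ; identity = (λ _ → ≋-refl) , ⊕-identityʳ }
            ; inverse = (λ p → ≋-trans (⊕-comm (neg p) p) (⊕-inverseʳ p)) , ⊕-inverseʳ
            ; ⁻¹-cong = neg-cong }
          ; comm = ⊕-comm }
        ; *-cong = ⊗-cong
        ; *-assoc = ⊗-assoc
        ; *-identity = ⊗-identityˡ ,
            (λ p → ≋-trans (⊗-comm p (1# ∷ [])) (⊗-identityˡ p))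
        ; distrib = ⊗-distribˡ-⊕ , ⊗-distribʳ-⊕ }
      ; *-comm = ⊗-comm } }

  -- Evaluation, synthetic division and leading coefficients.

  eval-⊕ : ∀ p q x → eval (p ⊕ q) x ≈ eval p x + eval q x
  eval-⊕ []      q       x = sym (+-identityˡ _)
  eval-⊕ (a ∷ p) []      x = sym (+-identityʳ _)
  eval-⊕ (a ∷ p) (b ∷ q) x = begin
    a + b + x * eval (p ⊕ q) x          ≈⟨ +-congˡ (*-congˡ (eval-⊕ p q x)) ⟩
    a + b + x * (eval p x + eval q x)   ≈⟨ solve 5 (λ a b x p q →
                                             a :+ b :+ x :* (p :+ q) :=
                                             a :+ x :* p :+ (b :+ x :* q)) refl a b x _ _ ⟩
    a + x * eval p x + (b + x * eval q x) ∎

  eval-scale : ∀ a p x → eval (scale a p) x ≈ a * eval p x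
  eval-scale a []      x = sym (zeroʳ a)
  eval-scale a (b ∷ p) x = begin
    a * b + x * eval (scale a p) x   ≈⟨ +-congˡ (*-congˡ (eval-scale a p x)) ⟩
    a * b + x * (a * eval p x)       ≈⟨ solve 4 (λ a b x p →
                                          a :* b :+ x :* (a :* p) := a :* (b :+ x :* p))
                                          refl a b x _ ⟩
    a * (b + x * eval p x)           ∎

  eval-⊗ : ∀ p q x → eval (p ⊗ q) x ≈ eval p x * eval q x
  eval-⊗ []      q x = sym (zeroˡ _)
  eval-⊗ (a ∷ p) q x = begin
    eval (scale a q ⊕ (0# ∷ (p ⊗ q))) x
      ≈⟨ eval-⊕ (scale a q) _ x ⟩
    eval (scale a q) x + (0# + x * eval (p ⊗ q) x)
      ≈⟨ +-cong (eval-scale a q x) (trans (+-identityˡ _) (*-congˡ (eval-⊗ p q x))) ⟩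
    a * eval q x + x * (eval p x * eval q x)
      ≈⟨ solve 4 (λ a x p q → a :* q :+ x :* (p :* q) := (a :+ x :* p) :* q) refl a x _ _ ⟩
    (a + x * eval p x) * eval q x ∎

  -- The quotient of p by X − w, by synthetic division.
  quot : Carrier → Pol → Pol
  quot w []          = []
  quot w (a ∷ [])    = []
  quot w (a ∷ b ∷ p) = eval (b ∷ p) w ∷ quot w (b ∷ p)

  -- Writing the point as `w + d` avoids subtraction, so each step is an identity of commutative
  -- semirings.
  eval-quot : ∀ p w d → eval p (w + d) ≈ eval p w + d * eval (quot w p) (w + d)
  eval-quot []       w d = sym (trans (+-identityˡ _) (zeroʳ d))
  eval-quot (a ∷ []) w d =
    solve 3 (λ a w d → a :+ (w :+ d) :* con 0 := a :+ w :* con 0 :+ d :* con 0) refl a w d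
  eval-quot (a ∷ b ∷ p) w d = begin
    a + (w + d) * eval (b ∷ p) (w + d)
      ≈⟨ +-congˡ (*-congˡ (eval-quot (b ∷ p) w d)) ⟩
    a + (w + d) * (eval (b ∷ p) w + d * eval (quot w (b ∷ p)) (w + d))
      ≈⟨ solve 5 (λ a w d p q → a :+ (w :+ d) :* (p :+ d :* q) :=
                               a :+ w :* p :+ d :* (p :+ (w :+ d) :* q)) refl a w d _ _ ⟩
    a + w * eval (b ∷ p) w + d * (eval (b ∷ p) w + (w + d) * eval (quot w (b ∷ p)) (w + d)) ∎

  eval-quot′ : ∀ p w z → eval p z ≈ eval p w + (z - w) * eval (quot w p) z
  eval-quot′ p w z = begin
    eval p z                                                ≈⟨ eval-cong p (sym eq) ⟩
    eval p (w + (z - w))                                    ≈⟨ eval-quot p w (z - w) ⟩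
    eval p w + (z - w) * eval (quot w p) (w + (z - w))      ≈⟨ +-congˡ (*-congˡ (eval-cong (quot w p) eq)) ⟩
    eval p w + (z - w) * eval (quot w p) z                  ∎
    where
    eq : w + (z - w) ≈ z
    eq = begin
      w + (z - w)   ≈⟨ x∙yz≈y∙xz w z (- w) ⟩
      z + (w - w)   ≈⟨ +-congˡ (-‿inverseʳ w) ⟩
      z + 0#        ≈⟨ +-identityʳ z ⟩
      z             ∎
    eval-cong : ∀ p {x y} → x ≈ y → eval p x ≈ eval p y
    eval-cong []      e = refl
    eval-cong (a ∷ p) e = +-congˡ (*-cong e (eval-cong p e))

  -- This and `coeff-quot-suc` are what comparing coefficients in p = (X - w)q + p(w) demands of the
  -- quotient q.
  coeff-quot-zero : ∀ p w → eval p w ≈ coeff p 0 + w * coeff (quot w p) 0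
  coeff-quot-zero []          w = sym (trans (+-identityˡ _) (zeroʳ w))
  coeff-quot-zero (a ∷ [])    w = refl
  coeff-quot-zero (a ∷ b ∷ p) w = refl

  coeff-quot-suc : ∀ p w i →
    coeff (quot w p) i ≈ coeff p (suc i) + w * coeff (quot w p) (suc i)
  coeff-quot-suc []          w i       = sym (trans (+-identityˡ _) (zeroʳ w))
  coeff-quot-suc (a ∷ [])    w i       = sym (trans (+-identityˡ _) (zeroʳ w))
  coeff-quot-suc (a ∷ b ∷ p) w zero    = coeff-quot-zero (b ∷ p) w
  coeff-quot-suc (a ∷ b ∷ p) w (suc i) = coeff-quot-suc (b ∷ p) w i

  X-_ : Carrier → Pol
  X- w = (- w) ∷ 1# ∷ []

  quot-spec : ∀ p w → p ≋ (((X- w) ⊗ quot w p) ⊕ (eval p w ∷ []))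
  quot-spec p w .coeffs i = sym (begin
    coeff (((X- w) ⊗ q) ⊕ (eval p w ∷ [])) i
      ≈⟨ coeff-⊕ ((X- w) ⊗ q) _ i ⟩
    coeff ((X- w) ⊗ q) i + coeff (eval p w ∷ []) i
      ≈⟨ +-congʳ (trans (coeff-∷-⊗ (- w) (1# ∷ []) q i)
           (+-congˡ (coeffs (∷-cong {0#} refl (⊗-identityˡ q)) i))) ⟩
    - w * coeff q i + coeff (0# ∷ q) i + coeff (eval p w ∷ []) i
      ≈⟨ lem i ⟩
    coeff p i ∎)
    where
    q = quot w p
    cancel : ∀ {x y z} → x ≈ y + w * z → - w * z + x ≈ y
    cancel {x} {y} {z} e = begin
      - w * z + x             ≈⟨ +-congˡ e ⟩
      - w * z + (y + w * z)   ≈⟨ x∙yz≈y∙xz _ _ _ ⟩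
      y + (- w * z + w * z)   ≈⟨ +-congˡ (distribʳ z (- w) w) ⟨
      y + (- w + w) * z       ≈⟨ +-congˡ (trans (*-congʳ (-‿inverseˡ w)) (zeroˡ z)) ⟩
      y + 0#                  ≈⟨ +-identityʳ y ⟩
      y                       ∎
    lem : ∀ i → - w * coeff q i + coeff (0# ∷ q) i + coeff (eval p w ∷ []) i ≈ coeff p i
    lem zero    = trans (+-congʳ (+-identityʳ _)) (cancel (coeff-quot-zero p w))
    lem (suc i) = trans (+-identityʳ _) (cancel (coeff-quot-suc p w i))

  -- The list has exactly `m + 1` entries, so the formal degree is structural: dividing by a linear
  -- factor lowers `m` by one, and inductions that remove one root at a time terminate.
  data HasLead (a : Carrier) : ℕ → Pol → Set (c ⊔ ℓ) where
    [_]  : ∀ {b} → b ≈ a → HasLead a 0 (b ∷ [])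
    cons : ∀ {b m p} → HasLead a m p → HasLead a (suc m) (b ∷ p)

  lead-coeff : ∀ {a m p} → HasLead a m p → coeff p m ≈ a
  lead-coeff [ e ]    = e
  lead-coeff (cons l) = lead-coeff l

  lead-quot : ∀ {a m p} w → HasLead a (suc m) p → HasLead a m (quot w p)
  lead-quot w (cons [ e ]) = [ trans (+-congˡ (zeroʳ w)) (trans (+-identityʳ _) e) ]
  lead-quot w (cons (cons l)) = cons (lead-quot w (cons l))

  lead-monic : ∀ {n} (a : Vec Carrier n) → HasLead 1# n (monic a)
  lead-monic []      = [ refl ]
  lead-monic (x ∷ a) = cons (lead-monic a)

  -- The entry at position i is multiplied by k + i, so the last one receives the factor k + m.
  lead-derivAux : ∀ {a m p} k → HasLead a m p → HasLead (natK (k +ℕ m) * a) m (derivAux k p)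
  lead-derivAux k [ e ] =
    [ *-cong (reflexive (≡.cong natK (≡.sym (ℕ.+-identityʳ k)))) e ]
  lead-derivAux {a} {suc m} k (cons {b} {m} {p} l) = cons (≡.subst
    (λ j → HasLead (natK j * a) m (derivAux (suc k) p))
    (≡.sym (ℕ.+-suc k m)) (lead-derivAux (suc k) l))

  lead-deriv : ∀ {a m p} → HasLead a (suc m) p → HasLead (natK (suc m) * a) m (deriv p)
  lead-deriv (cons l) = lead-derivAux 1 l

-- Order and multiplication of absolute values.

module ValuedField {c ℓ} (K : CommutativeRing c ℓ) (V : NonArchAbs K) (F : IsField K) where
  open CommutativeRing K
  open NonArchAbs V
  open Valued K V
  open Poly K
  open PolynomialRing K
  open import Algebra.Properties.Ring ring using (-1*x≈-x; -‿involutive)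

  -- If u ≡ v then ≤-total u v and ≤-total v u are the same value, so that their tags
  -- agree; conversely, equal tags give both inequalities.
  _≟ᵥ_ : (u v : Γ) → Dec (u ≡ v)
  u ≟ᵥ v with ≤-total u v in e | ≤-total v u in e′
  ... | inj₁ u≤v | inj₁ v≤u = yes (≤-antisym u≤v v≤u)
  ... | inj₂ v≤u | inj₂ u≤v = yes (≤-antisym u≤v v≤u)
  ... | inj₁ _   | inj₂ _   = no λ { ≡.refl → case ≡.trans (≡.sym e) e′ of λ () }
  ... | inj₂ _   | inj₁ _   = no λ { ≡.refl → case ≡.trans (≡.sym e) e′ of λ () }

  ≤-reflexive : ∀ {u v} → u ≡ v → u ≤ᵥ v
  ≤-reflexive ≡.refl = ≤-refl

  1ᵥ≢0ᵥ : ¬ (1ᵥ ≡ 0ᵥ)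
  1ᵥ≢0ᵥ e = IsField.nontrivial F (abs-zero 1# (begin
    ∣ 1# ∣         ≡⟨ ·-identity _ ⟨
    1ᵥ ·ᵥ ∣ 1# ∣   ≡⟨ ≡.cong (_·ᵥ ∣ 1# ∣) e ⟩
    0ᵥ ·ᵥ ∣ 1# ∣   ≡⟨ ·-zero _ ⟩
    0ᵥ             ∎))
    where open ≡.≡-Reasoning

  -- From 1 · 1 = 1, the value |1| is idempotent; it is nonzero and hence cancels.
  abs-1 : ∣ 1# ∣ ≡ 1ᵥ
  abs-1 = ≡.sym (·-cancel ∣ 1# ∣ (λ e → IsField.nontrivial F (abs-zero 1# e)) (begin
    1ᵥ ·ᵥ ∣ 1# ∣       ≡⟨ ·-identity _ ⟩
    ∣ 1# ∣             ≡⟨ abs-cong (*-identityˡ 1#) ⟨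
    ∣ 1# * 1# ∣        ≡⟨ abs-mult 1# 1# ⟩
    ∣ 1# ∣ ·ᵥ ∣ 1# ∣   ∎))
    where open ≡.≡-Reasoning

  ≤1-*-≤ : ∀ {u} v → u ≤ᵥ 1ᵥ → (u ·ᵥ v) ≤ᵥ v
  ≤1-*-≤ {u} v u≤1 = ≡.subst ((u ·ᵥ v) ≤ᵥ_) (·-identity v) (·-mono v u≤1)

  1≤-≤-* : ∀ {u} v → 1ᵥ ≤ᵥ u → v ≤ᵥ (u ·ᵥ v)
  1≤-≤-* {u} v 1≤u = ≡.subst (_≤ᵥ (u ·ᵥ v)) (·-identity v) (·-mono v 1≤u)

  -- The order leaves no other square root of 1: if u ≤ 1 then 1 = u² ≤ u, and dually if u ≥ 1. This
  -- gives |-1| = 1.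
  u·u≡1⇒u≡1 : ∀ {u} → u ·ᵥ u ≡ 1ᵥ → u ≡ 1ᵥ
  u·u≡1⇒u≡1 {u} e with ≤-total u 1ᵥ
  ... | inj₁ u≤1 = ≤-antisym u≤1 (≡.subst (_≤ᵥ u) e (≤1-*-≤ u u≤1))
  ... | inj₂ 1≤u = ≤-antisym (≡.subst (u ≤ᵥ_) e (1≤-≤-* u 1≤u)) 1≤u

  abs-neg : ∀ x → ∣ - x ∣ ≡ ∣ x ∣
  abs-neg x = begin
    ∣ - x ∣                ≡⟨ abs-cong (-1*x≈-x x) ⟨
    ∣ - 1# * x ∣           ≡⟨ abs-mult (- 1#) x ⟩
    ∣ - 1# ∣ ·ᵥ ∣ x ∣      ≡⟨ ≡.cong (_·ᵥ ∣ x ∣) (u·u≡1⇒u≡1 (begin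
      ∣ - 1# ∣ ·ᵥ ∣ - 1# ∣   ≡⟨ abs-mult (- 1#) (- 1#) ⟨
      ∣ - 1# * - 1# ∣        ≡⟨ abs-cong (trans (-1*x≈-x (- 1#)) (-‿involutive 1#)) ⟩
      ∣ 1# ∣                 ≡⟨ abs-1 ⟩
      1ᵥ                     ∎)) ⟩
    1ᵥ ·ᵥ ∣ x ∣            ≡⟨ ·-identity _ ⟩
    ∣ x ∣                  ∎
    where open ≡.≡-Reasoning

  -- The valuation ring and its maximal ideal.

  InO-resp : ∀ {x y} → x ≈ y → InO x → InO y
  InO-resp e = ≡.subst (_≤ᵥ 1ᵥ) (abs-cong e)

  InO-0 : InO 0#
  InO-0 = ≡.subst (_≤ᵥ 1ᵥ) (≡.sym abs-zero′) (0-least 1ᵥ)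

  InO-1 : InO 1#
  InO-1 = ≤-reflexive abs-1

  InO-+ : ∀ {x y} → InO x → InO y → InO (x + y)
  InO-+ {x} {y} x∈O y∈O with ultra x y
  ... | inj₁ le = ≤-trans le x∈O
  ... | inj₂ le = ≤-trans le y∈O

  InO-* : ∀ {x y} → InO x → InO y → InO (x * y)
  InO-* {x} {y} x∈O y∈O =
    ≡.subst (_≤ᵥ 1ᵥ) (≡.sym (abs-mult x y)) (≤-trans (≤1-*-≤ ∣ y ∣ x∈O) y∈O)

  InO-neg : ∀ {x} → InO x → InO (- x)
  InO-neg {x} = ≡.subst (_≤ᵥ 1ᵥ) (≡.sym (abs-neg x))

  InO-natK : ∀ n → InO (natK n)
  InO-natK zero    = InO-0
  InO-natK (suc n) = InO-+ InO-1 (InO-natK n)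

  1≤⇒∉M : ∀ {x} → 1ᵥ ≤ᵥ ∣ x ∣ → ¬ InM x
  1≤⇒∉M 1≤x (x≤1 , x≢1) = x≢1 (≤-antisym x≤1 1≤x)

  ≤-InM : ∀ {x y} → ∣ x ∣ ≤ᵥ ∣ y ∣ → InM y → InM x
  ≤-InM {x} {y} x≤y (y≤1 , y≢1) = ≤-trans x≤y y≤1 ,
    λ x≡1 → y≢1 (≤-antisym y≤1 (≡.subst (_≤ᵥ ∣ y ∣) x≡1 x≤y))

  InM-resp : ∀ {x y} → x ≈ y → InM x → InM y
  InM-resp e = ≤-InM (≤-reflexive (abs-cong (sym e)))

  InM-0 : InM 0#
  InM-0 = InO-0 , λ e → 1ᵥ≢0ᵥ (≡.trans (≡.sym e) abs-zero′)

  InM-+ : ∀ {x y} → InM x → InM y → InM (x + y)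
  InM-+ {x} {y} x∈M y∈M with ultra x y
  ... | inj₁ le = ≤-InM le x∈M
  ... | inj₂ le = ≤-InM le y∈M

  InM-*ˡ : ∀ {x y} → InO x → InM y → InM (x * y)
  InM-*ˡ {x} {y} x∈O = ≤-InM (≡.subst (_≤ᵥ ∣ y ∣) (≡.sym (abs-mult x y)) (≤1-*-≤ ∣ y ∣ x∈O))

  InM-*ʳ : ∀ {x y} → InM x → InO y → InM (x * y)
  InM-*ʳ {x} {y} x∈M y∈O = InM-resp (*-comm y x) (InM-*ˡ y∈O x∈M)

  InM-neg : ∀ {x} → InM x → InM (- x)
  InM-neg {x} = ≤-InM (≤-reflexive (abs-neg x))

  -- Polynomials with coefficients in the valuation ring or the maximal ideal.

  AllCoeffs : ∀ {p} → (Carrier → Set p) → Pol → Set p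
  AllCoeffs P f = ∀ i → P (coeff f i)

  -- Three separate predicates let one induction cover 𝒪·𝒪 ⊆ 𝒪, 𝒪·𝔪 ⊆ 𝔪 and 𝔪·𝒪 ⊆ 𝔪.
  coeffs-⊗ : ∀ {p q s} {P : Carrier → Set p} {Q : Carrier → Set q} {S : Carrier → Set s} →
    (∀ {x y} → x ≈ y → S x → S y) → S 0# → (∀ {x y} → S x → S y → S (x + y)) →
    (∀ {x y} → P x → Q y → S (x * y)) →
    ∀ f g → AllCoeffs P f → AllCoeffs Q g → AllCoeffs S (f ⊗ g)
  coeffs-⊗ resp z add mul []      g Pf Qg i = z
  coeffs-⊗ {P = P} {Q} {S} resp z add mul (a ∷ f) g Pf Qg i =
    resp (sym (coeff-∷-⊗ a f g i)) (add (mul (Pf 0) (Qg i)) (shifted i))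
    where
    shifted : AllCoeffs S (0# ∷ (f ⊗ g))
    shifted zero    = z
    shifted (suc i) = coeffs-⊗ resp z add mul f g (λ i → Pf (suc i)) Qg i

  O-⊗ : ∀ f g → AllCoeffs InO f → AllCoeffs InO g → AllCoeffs InO (f ⊗ g)
  O-⊗ = coeffs-⊗ InO-resp InO-0 InO-+ InO-*

  M-⊗ˡ : ∀ f g → AllCoeffs InO f → AllCoeffs InM g → AllCoeffs InM (f ⊗ g)
  M-⊗ˡ = coeffs-⊗ InM-resp InM-0 InM-+ InM-*ˡ

  M-⊗ʳ : ∀ f g → AllCoeffs InM f → AllCoeffs InO g → AllCoeffs InM (f ⊗ g)
  M-⊗ʳ = coeffs-⊗ InM-resp InM-0 InM-+ InM-*ʳ

  O-⊕ : ∀ f g → AllCoeffs InO f → AllCoeffs InO g → AllCoeffs InO (f ⊕ g)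
  O-⊕ f g Of Og i = InO-resp (sym (coeff-⊕ f g i)) (InO-+ (Of i) (Og i))

  M-⊕ : ∀ f g → AllCoeffs InM f → AllCoeffs InM g → AllCoeffs InM (f ⊕ g)
  M-⊕ f g Mf Mg i = InM-resp (sym (coeff-⊕ f g i)) (InM-+ (Mf i) (Mg i))

  M-neg : ∀ f → AllCoeffs InM f → AllCoeffs InM (neg f)
  M-neg f Mf i = InM-resp (sym (coeff-neg f i)) (InM-neg (Mf i))

  O-[_] : ∀ {x} → InO x → AllCoeffs InO (x ∷ [])
  O-[ x∈O ] zero    = x∈O
  O-[ x∈O ] (suc i) = InO-0

  M-[_] : ∀ {x} → InM x → AllCoeffs InM (x ∷ [])
  M-[ x∈M ] zero    = x∈M
  M-[ x∈M ] (suc i) = InM-0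

  O-X- : ∀ {w} → InO w → AllCoeffs InO (X- w)
  O-X- w∈O zero    = InO-neg w∈O
  O-X- w∈O (suc i) = O-[ InO-1 ] i

  O-^^ : ∀ f m → AllCoeffs InO f → AllCoeffs InO (f ^^ m)
  O-^^ f zero    Of = O-[ InO-1 ]
  O-^^ f (suc m) Of = O-⊗ f (f ^^ m) Of (O-^^ f m Of)

  O-deriv : ∀ f → AllCoeffs InO f → AllCoeffs InO (deriv f)
  O-deriv []      Of i = InO-0
  O-deriv (a ∷ f) Of   = aux 1 f (λ i → Of (suc i))
    where
    aux : ∀ k f → AllCoeffs InO f → AllCoeffs InO (derivAux k f)
    aux k []      Of i       = InO-0
    aux k (a ∷ f) Of zero    = InO-* (InO-natK k) (Of 0)
    aux k (a ∷ f) Of (suc i) = aux (suc k) f (λ i → Of (suc i)) i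

  O-eval : ∀ f {x} → AllCoeffs InO f → InO x → InO (eval f x)
  O-eval []      Of x∈O = InO-0
  O-eval (a ∷ f) Of x∈O = InO-+ (Of 0) (InO-* x∈O (O-eval f (λ i → Of (suc i)) x∈O))

  M-eval : ∀ f {x} → AllCoeffs InM f → InO x → InM (eval f x)
  M-eval []      Mf x∈O = InM-0
  M-eval (a ∷ f) Mf x∈O = InM-+ (Mf 0) (InM-*ˡ x∈O (M-eval f (λ i → Mf (suc i)) x∈O))

  O-quot : ∀ f {w} → AllCoeffs InO f → InO w → AllCoeffs InO (quot w f)
  O-quot []          Of w∈O i       = InO-0
  O-quot (a ∷ [])    Of w∈O i       = InO-0
  O-quot (a ∷ b ∷ f) Of w∈O zero    = O-eval (b ∷ f) (λ i → Of (suc i)) w∈O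
  O-quot (a ∷ b ∷ f) Of w∈O (suc i) = O-quot (b ∷ f) (λ i → Of (suc i)) w∈O i

  -- Splitting off a root, and the size of roots.

  root-quot : ∀ p {w z} → eval p w ≈ 0# → eval (quot w p) z ≈ 0# → eval p z ≈ 0#
  root-quot p {w} {z} pw qz = begin
    eval p z                                   ≈⟨ eval-quot′ p w z ⟩
    eval p w + (z - w) * eval (quot w p) z     ≈⟨ +-cong pw (trans (*-congˡ qz) (zeroʳ _)) ⟩
    0# + 0#                                    ≈⟨ +-identityˡ 0# ⟩
    0#                                         ∎
    where open import Relation.Binary.Reasoning.Setoid setoid

  -- Used repeatedly, this turns |p(z)| into a product of distances from z to the roots of p.
  abs-eval-root : ∀ p {w} z → eval p w ≈ 0# →
    ∣ eval p z ∣ ≡ ∣ z - w ∣ ·ᵥ ∣ eval (quot w p) z ∣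
  abs-eval-root p {w} z pw = ≡.trans
    (abs-cong (trans (eval-quot′ p w z) (trans (+-congʳ pw) (+-identityˡ _))))
    (abs-mult (z - w) (eval (quot w p) z))

  -- A root w with |w| > 1 is impossible: by Horner's scheme |p(w)| ≥ 1.
  root-bound : ∀ {a m p w} → HasLead a m p → ∣ a ∣ ≡ 1ᵥ → AllCoeffs InO p →
    eval p w ≈ 0# → InO w
  root-bound {w = w} l |a|≡1 Op pw with ≤-total ∣ w ∣ 1ᵥ | ∣ w ∣ ≟ᵥ 1ᵥ
  ... | inj₁ w≤1 | _      = w≤1
  ... | inj₂ 1≤w | yes e  = ≤-reflexive e
  ... | inj₂ 1≤w | no w≢1 =
    ⊥-elim (1≤⇒∉M (≡.subst (1ᵥ ≤ᵥ_) (abs-cong pw) (large l |a|≡1 Op)) InM-0)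
    where
    large : ∀ {a m p} → HasLead a m p → ∣ a ∣ ≡ 1ᵥ → AllCoeffs InO p → 1ᵥ ≤ᵥ ∣ eval p w ∣
    large [ e ] |a|≡1 Op = ≤-reflexive (≡.sym (≡.trans
      (abs-cong (trans (+-congˡ (zeroʳ w)) (trans (+-identityʳ _) e))) |a|≡1))
    large (cons {b} {p = p} l) |a|≡1 Op = conclude (ultra (b + w * eval p w) (- b))
      where
      w≤wp : ∣ w ∣ ≤ᵥ ∣ w * eval p w ∣
      w≤wp = ≡.subst (∣ w ∣ ≤ᵥ_)
        (≡.trans (·-comm _ _) (≡.sym (abs-mult w (eval p w))))
        (1≤-≤-* ∣ w ∣ (large l |a|≡1 (λ i → Op (suc i))))
      drop-b : b + w * eval p w + - b ≈ w * eval p w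
      drop-b = trans (+-congʳ (+-comm b _)) (trans (+-assoc _ b (- b))
        (trans (+-congˡ (-‿inverseʳ b)) (+-identityʳ _)))
      w≤ : ∣ w ∣ ≤ᵥ ∣ b + w * eval p w + - b ∣
      w≤ = ≡.subst (∣ w ∣ ≤ᵥ_) (≡.sym (abs-cong drop-b)) w≤wp
      -- `w * eval p w` is the sum of `b + w * eval p w` and `- b`. It has absolute value at least
      -- |w| > 1, which |b| ≤ 1 cannot bound, so the ultrametric inequality bounds it by the other
      -- summand.
      conclude : (∣ b + w * eval p w + - b ∣ ≤ᵥ ∣ b + w * eval p w ∣) ⊎
                 (∣ b + w * eval p w + - b ∣ ≤ᵥ ∣ - b ∣) → 1ᵥ ≤ᵥ ∣ b + w * eval p w ∣
      conclude (inj₁ le) = ≤-trans 1≤w (≤-trans w≤ le)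
      conclude (inj₂ le) =
        ⊥-elim (w≢1 (≤-antisym (≤-trans w≤ (≤-trans le (InO-neg (Op 0)))) 1≤w))

  -- Factorization over an algebraically closed field.

  module _ (closed : AlgClosed) where

    -- A leading coefficient of absolute value 1 is nonzero, and its index `suc m` is positive, so
    -- `p` is nonconstant.
    root : ∀ {a m p} → HasLead a (suc m) p → ∣ a ∣ ≡ 1ᵥ → ∃ λ z → eval p z ≈ 0#
    root {m = m} {p} l |a|≡1 = closed p (m , λ e → 1ᵥ≢0ᵥ (begin
      1ᵥ       ≡⟨ |a|≡1 ⟨
      _        ≡⟨ abs-cong (trans (sym (lead-coeff l)) e) ⟩
      ∣ 0# ∣   ≡⟨ abs-zero′ ⟩
      0ᵥ       ∎))
      where open ≡.≡-Reasoning

    -- By induction `p` is a constant of absolute value 1 times factors X - w with w in 𝒪. Roots of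
    -- the quotient are roots of `p`, so the hypothesis is inherited.
    integral-coeffs : ∀ {a m p} → HasLead a m p → ∣ a ∣ ≡ 1ᵥ →
      (∀ z → eval p z ≈ 0# → InO z) → AllCoeffs InO p
    integral-coeffs [ e ] |a|≡1 roots∈O =
      O-[ ≤-reflexive (≡.trans (abs-cong e) |a|≡1) ]
    integral-coeffs {p = p} l@(cons _) |a|≡1 roots∈O with root l |a|≡1
    ... | w , pw = λ i → InO-resp (sym (coeffs (quot-spec p w) i))
      (O-⊕ ((X- w) ⊗ quot w p) (eval p w ∷ [])
        (O-⊗ (X- w) (quot w p) (O-X- (roots∈O w pw))
          (integral-coeffs (lead-quot w l) |a|≡1 (λ z qz → roots∈O z (root-quot p pw qz))))
        O-[ InO-resp (sym pw) InO-0 ] i)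

    -- |p(z)| is |a| = 1 times the distances from z to the roots, each at least 1.
    far-from-roots : ∀ {a m p} → HasLead a m p → ∣ a ∣ ≡ 1ᵥ → ∀ z →
      (∀ w → eval p w ≈ 0# → 1ᵥ ≤ᵥ ∣ z - w ∣) → 1ᵥ ≤ᵥ ∣ eval p z ∣
    far-from-roots [ e ] |a|≡1 z far = ≤-reflexive (≡.sym (≡.trans
      (abs-cong (trans (+-congˡ (zeroʳ z)) (trans (+-identityʳ _) e))) |a|≡1))
    far-from-roots {p = p} l@(cons _) |a|≡1 z far with root l |a|≡1
    ... | w , pw = ≡.subst (1ᵥ ≤ᵥ_) (≡.sym (abs-eval-root p z pw))
      (≤-trans (far-from-roots (lead-quot w l) |a|≡1 z (λ v qv → far v (root-quot p pw qv)))
               (1≤-≤-* _ (far w pw)))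

    -- If the linear factor X − z of p divides h modulo 𝔪 for every root z of p, then the
    -- product of these factors divides the corresponding power of h.
    unit-value-or-divides : ∀ {m p} → HasLead 1# m p → (∀ z → eval p z ≈ 0# → InO z) →
      ∀ h → AllCoeffs InO h →
      (∃ λ z → (eval p z ≈ 0#) × (∣ eval h z ∣ ≡ 1ᵥ)) ⊎
      (∃ λ g → ∃ λ d → AllCoeffs InO g × AllCoeffs InM d × ((p ⊗ g) ≋ ((h ^^ m) ⊕ d)))
    unit-value-or-divides [ e ] roots∈O h Oh =
      inj₂ ((1# ∷ []) , [] , O-[ InO-1 ] , (λ _ → InM-0) ,
            ≋-trans (⊗-cong (∷-cong e (≋-refl {[]})) (≋-refl {1# ∷ []})) (⊗-identityˡ (1# ∷ [])))
    unit-value-or-divides {suc m} {p} l@(cons _) roots∈O h Oh with root l abs-1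
    ... | z , pz with ∣ eval h z ∣ ≟ᵥ 1ᵥ
    ... | yes e  = inj₁ (z , pz , e)
    -- Here |h(z)| ≤ 1 but not 1, so h(z) lies in 𝔪 and X - z divides h modulo 𝔪, with quotient
    -- `quot z h`.
    ... | no h≢1 with unit-value-or-divides (lead-quot z l)
                        (λ w qw → roots∈O w (root-quot p pz qw)) h Oh
    ... | inj₁ (w , qw , e) = inj₁ (w , root-quot p pz qw , e)
    ... | inj₂ (g , d , Og , Md , qg) =
      inj₂ ((k ⊗ g) , e , O-⊗ k g Ok Og , Me , eq)
      where
      open CommutativeRing polynomialRing using ()
        renaming (setoid to ≋-setoid; *-commutativeSemigroup to ⊗-commutativeSemigroup;
                  +-commutativeMonoid to ⊕-commutativeMonoid)
      open import Algebra.Properties.CommutativeSemigroup ⊗-commutativeSemigroup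
        using () renaming (interchange to ⊗-interchange)
      open import Algebra.Properties.CommutativeSemigroup
        (CommutativeMonoid.commutativeSemigroup ⊕-commutativeMonoid)
        using () renaming (interchange to ⊕-interchange)
      open import Relation.Binary.Reasoning.Setoid ≋-setoid
      t k q H C e : Pol
      t = X- z
      k = quot z h
      q = quot z p
      H = h ^^ m
      C = (eval h z ∷ []) ⊗ H
      -- Since h = tk + h(z), the product (tk)(H + d) equals hH + (tk)d - h(z)H. Both error terms
      -- have coefficients in 𝔪, the first through `d` and the second through h(z).
      e = ((t ⊗ k) ⊗ d) ⊕ neg C
      z∈O : InO z
      z∈O = roots∈O z pz
      Ok : AllCoeffs InO k
      Ok = O-quot h Oh z∈O
      Me : AllCoeffs InM e
      Me = M-⊕ ((t ⊗ k) ⊗ d) (neg C) (M-⊗ˡ (t ⊗ k) d (O-⊗ t k (O-X- z∈O) Ok) Md)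
        (M-neg C (M-⊗ʳ (eval h z ∷ []) H M-[ O-eval h Oh z∈O , h≢1 ] (O-^^ h m Oh)))
      p≋tq : p ≋ (t ⊗ q)
      p≋tq = ≋-trans (quot-spec p z)
        (≋-trans (⊕-cong (≋-refl {t ⊗ q}) const≋[]) (⊕-identityʳ (t ⊗ q)))
        where
        const≋[] : (eval p z ∷ []) ≋ []
        const≋[] .coeffs zero    = pz
        const≋[] .coeffs (suc _) = refl
      eq : (p ⊗ (k ⊗ g)) ≋ ((h ⊗ H) ⊕ e)
      eq = begin
        p ⊗ (k ⊗ g)
          ≈⟨ ⊗-cong p≋tq ≋-refl ⟩
        (t ⊗ q) ⊗ (k ⊗ g)
          ≈⟨ ⊗-interchange t q k g ⟩
        (t ⊗ k) ⊗ (q ⊗ g)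
          ≈⟨ ⊗-congˡ (t ⊗ k) qg ⟩
        (t ⊗ k) ⊗ (H ⊕ d)
          ≈⟨ ⊗-distribˡ-⊕ (t ⊗ k) H d ⟩
        ((t ⊗ k) ⊗ H) ⊕ ((t ⊗ k) ⊗ d)
          ≈⟨ ⊕-identityʳ _ ⟨
        (((t ⊗ k) ⊗ H) ⊕ ((t ⊗ k) ⊗ d)) ⊕ []
          ≈⟨ ⊕-cong ≋-refl (⊕-inverseʳ C) ⟨
        (((t ⊗ k) ⊗ H) ⊕ ((t ⊗ k) ⊗ d)) ⊕ (C ⊕ neg C)
          ≈⟨ ⊕-interchange ((t ⊗ k) ⊗ H) ((t ⊗ k) ⊗ d) C (neg C) ⟩
        (((t ⊗ k) ⊗ H) ⊕ C) ⊕ e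
          ≈⟨ ⊕-cong (⊗-distribʳ-⊕ H (t ⊗ k) (eval h z ∷ [])) ≋-refl ⟨
        (((t ⊗ k) ⊕ (eval h z ∷ [])) ⊗ H) ⊕ e
          ≈⟨ ⊕-cong (⊗-cong (quot-spec h z) ≋-refl) ≋-refl ⟨
        (h ⊗ H) ⊕ e ∎

  -- Values of powers and of multiples modulo the maximal ideal.

  1≤-eval-^^ : ∀ h z m → 1ᵥ ≤ᵥ ∣ eval h z ∣ → 1ᵥ ≤ᵥ ∣ eval (h ^^ m) z ∣
  1≤-eval-^^ h z zero    1≤h = ≤-reflexive (≡.sym (≡.trans
    (abs-cong (trans (+-congˡ (zeroʳ z)) (+-identityʳ 1#))) abs-1))
  1≤-eval-^^ h z (suc m) 1≤h = ≡.subst (1ᵥ ≤ᵥ_)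
    (≡.sym (≡.trans (abs-cong (eval-⊗ h (h ^^ m) z)) (abs-mult (eval h z) _)))
    (≤-trans (1≤-eval-^^ h z m 1≤h) (1≤-≤-* _ 1≤h))

  -- At a root of p the remainder pg - q takes the value -q(z), and its coefficients lie in 𝔪.
  divisor-root∈M : ∀ p q {z} → ResDivides p q → eval p z ≈ 0# → InO z → InM (eval q z)
  divisor-root∈M p q {z} (g , _ , rem∈M) pz z∈O =
    ≤-InM (≤-reflexive (≡.trans (≡.sym (abs-neg (eval q z))) (abs-cong (sym value))))
      (M-eval ((p ⊗ g) ⊕ neg q) rem∈M z∈O)
    where
    open import Relation.Binary.Reasoning.Setoid setoid
    value : eval ((p ⊗ g) ⊕ neg q) z ≈ - eval q z
    value = begin
      eval ((p ⊗ g) ⊕ neg q) z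
        ≈⟨ eval-⊕ (p ⊗ g) (neg q) z ⟩
      eval (p ⊗ g) z + eval (neg q) z
        ≈⟨ +-cong (trans (eval-⊗ p g z) (trans (*-congʳ pz) (zeroˡ _)))
                  (trans (eval-scale (- 1#) q z) (-1*x≈-x _)) ⟩
      0# + - eval q z
        ≈⟨ +-identityˡ _ ⟩
      - eval q z ∎

-- Unit distance to the critical points and divisibility of reductions.

theorem3 : ∀ {c ℓ} (K : CommutativeRing c ℓ) (V : NonArchAbs K) →
    IsField K → Poly.AlgClosed K → Poly.CharZero K →
    (n : ℕ) → 2 ≤ℕ n → (a : Vec (CommutativeRing.Carrier K) n) →
    (∀ z → CommutativeRing._≈_ K (Poly.eval K (Poly.monic K a) z) (CommutativeRing.0# K) →
    NonArchAbs._≤ᵥ_ V (NonArchAbs.∣_∣ V z) (NonArchAbs.1ᵥ V)) →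
    NonArchAbs.∣_∣ V (Poly.natK K n) ≡ NonArchAbs.1ᵥ V →
    (Valued.IsI K V (Poly.monic K a) (NonArchAbs.1ᵥ V) →
    ¬ Valued.ResDivides K V (Poly.monic K a)
    (Poly._^^_ K (Poly.deriv K (Poly.monic K a)) n)) ×
    (¬ Valued.ResDivides K V (Poly.monic K a)
    (Poly._^^_ K (Poly.deriv K (Poly.monic K a)) n) →
    Valued.IsI K V (Poly.monic K a) (NonArchAbs.1ᵥ V))
theorem3 K V F closed _ n@(suc (suc m)) (s≤s (s≤s _)) a roots∈O |n|≡1 = necessary , sufficient
  where
  open CommutativeRing K
  open NonArchAbs V
  open Valued K V
  open Poly K
  open PolynomialRing K
  open ValuedField K V F

  f h : Pol
  f = monic a
  h = deriv f

  -- As n ≥ 2, the degree `suc m` of the derivative is positive, so critical points exist. Its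
  -- leading coefficient is n, which has absolute value 1.
  lead-h : HasLead (natK n * 1#) (suc m) h
  lead-h = lead-deriv (lead-monic a)

  |lead-h|≡1 : ∣ natK n * 1# ∣ ≡ 1ᵥ
  |lead-h|≡1 = ≡.trans (abs-cong (*-identityʳ (natK n))) |n|≡1

  Oh : AllCoeffs InO h
  Oh = O-deriv f (integral-coeffs closed (lead-monic a) abs-1 roots∈O)

  distance≤1 : ∀ {z w} → eval f z ≈ 0# → eval h w ≈ 0# → ∣ z - w ∣ ≤ᵥ 1ᵥ
  distance≤1 fz hw =
    InO-+ (roots∈O _ fz) (InO-neg (root-bound lead-h |lead-h|≡1 Oh hw))

  necessary : IsI f 1ᵥ → ¬ ResDivides f (h ^^ n)
  -- A root z whose nearest critical point is at distance 1 has |h(z)| ≥ 1, hence |h(z)ⁿ| ≥ 1;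
  -- divisibility would put h(z)ⁿ in 𝔪.
  necessary ((z , fz , _ , far) , _) f∣hⁿ =
    1≤⇒∉M (1≤-eval-^^ h z n (far-from-roots closed lead-h |lead-h|≡1 z far))
      (divisor-root∈M f (h ^^ n) f∣hⁿ fz (roots∈O z fz))

  sufficient : ¬ ResDivides f (h ^^ n) → IsI f 1ᵥ
  sufficient f∤hⁿ with unit-value-or-divides closed (lead-monic a) roots∈O h Oh
  ... | inj₂ (g , d , Og , Md , fg) =
    ⊥-elim (f∤hⁿ (g , Og , λ i → InM-resp (sym (coeffs remainder i)) (Md i)))
    where
    H : Pol
    H = h ^^ n
    remainder : ((f ⊗ g) ⊕ neg H) ≋ d
    remainder =
      ≋-trans (⊕-cong (≋-trans fg (⊕-comm H d)) (≋-refl {neg H}))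
      (≋-trans (⊕-assoc d H (neg H))
      (≋-trans (⊕-cong (≋-refl {d}) (⊕-inverseʳ H)) (⊕-identityʳ d)))
  ... | inj₁ (z , fz , |hz|≡1) =
    -- For maximality, any minimal distance `v` is realized by some critical point, so `distance≤1`
    -- bounds it.
    (z , fz , attained , far) , λ { z′ v fz′ ((w , hw , e) , _) →
      ≡.subst (_≤ᵥ 1ᵥ) e (distance≤1 fz′ hw) }
    where
    -- 1 = |h(z)| is |z - w| times the value at z of the integral quotient `quot w h`, a factor at
    -- most 1; hence |z - w| ≥ 1.
    far : ∀ w → eval h w ≈ 0# → 1ᵥ ≤ᵥ ∣ z - w ∣
    far w hw = ≡.subst₂ _≤ᵥ_
      (≡.trans (·-comm _ _) (≡.trans (≡.sym (abs-eval-root h z hw)) |hz|≡1)) ≡.refl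
      (≤1-*-≤ ∣ z - w ∣ (O-eval (quot w h)
        (O-quot h Oh (root-bound lead-h |lead-h|≡1 Oh hw)) (roots∈O z fz)))
    attained : ∃ λ w → (eval h w ≈ 0#) × (∣ z - w ∣ ≡ 1ᵥ)
    -- Any critical point serves, since `far` and `distance≤1` force every distance from z to be
    -- exactly 1.
    attained with root closed lead-h |lead-h|≡1
    ... | w , hw = w , hw , ≤-antisym (distance≤1 fz hw) (far w hw)
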